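{- A cograph is well-equi-hued if and only if its corresponding cotree satisfies the uniform assignment property.
   Context: All graphs are finite and simple. For $k\ge 1$, a maximal $k$-colorable subgraph of $G$ is a subgraph induced by a set $S\subseteq V(G)$ such that $G[S]$ is (properly) $k$-colorable and $G[S']$ is not $k$-colorable for every $S'$ with $S\subsetneq S'\subseteq V(G)$. $G$ is well-hued if for every $k\ge 1$ all maximal $k$-colorable subgraphs of $G$ have the same order, denoted $a_k$. A graph $G$ of order $n$ with chromatic number $\chi$ is well-equi-hued if it is well-hued and $a_i=\frac{i}{\chi}n$ for all $i\in\{1,\dots,\chi\}$. Cographs are the smallest class of graphs containing $K_1$ and closed under disjoint unions and joins (the join of graphs is their disjoint union together with all edges between different graphs). The cotree $T_G$ of a cograph $G$ is the (unique) rooted tree such that: its leaves are labeled with the vertices of $G$; each internal (non-leaf) node is labeled $0$ (disjoint union) or $1$ (join), with no two adjacent internal nodes having the same label; every internal node has two or more children, unless $G$ is a single vertex; and $G$ is obtained by letting each leaf represent a single-vertex graph, each $0$-node the disjoint union of the graphs represented by its children, and each $1$-node the join of the graphs represented by its children, with the root representing $G$. Procedure 1 on a cotree: assign the value 1 to each leaf; to each internal node at even distance from the root (including the root) assign the sum of the values of its children; to each internal node at odd distance from the root assign the maximum of the values of its children. Procedure 2: assign the value 1 to each leaf; to each internal node at odd distance from the root assign the sum of the values of its children; to each internal node at even distance from the root assign the maximum of the values of its children. The cotree $T_G$ satisfies the uniform assignment property if (i) when values are assigned by Procedure 1, for every node $v$ at odd distance from the root all children of $v$ have the same value, and (ii)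 when values are assigned by Procedure 2, for every node $v$ at even distance from the root all children of $v$ have the same value. -}

module Defs where

open import Data.Empty using (⊥)
open import Data.Fin.Base using (Fin)
open import Data.Fin.Subset using (Subset; _∈_; _⊂_; ∣_∣)
open import Data.Nat.Base using (ℕ; suc; _+_; _*_; _⊔_; _≤_)
open import Data.Parity.Base using (Parity; 0ℙ; 1ℙ; _⁻¹)
open import Data.Product.Base using (Σ; ∃; _×_; _,_; proj₁)
open import Data.Unit.Base using (⊤)
open import Data.Vec.Functional using (Vector; foldr)
open import Function.Bundles using (_↔_; _⇔_; Inverse)
open import Relation.Binary.PropositionalEquality using (_≡_; _≢_; refl; sym)
open import Relation.Nullary.Negation using (¬_)

-- Simple graphs on a vertex type V.  Finite graphs of order n are the graphs
-- on Fin n.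

record Graph (V : Set) : Set₁ where
  field
    Adj        : V → V → Set
    symmetric   : ∀ {u v} → Adj u v → Adj v u
    irreflexive : ∀ {v} → ¬ Adj v v

open Graph public

infix 4 _≅_

record _≅_ {V W : Set} (G : Graph V) (H : Graph W) : Set where
  field
    bijection : V ↔ W
    adjacency : ∀ u v →
      Adj G u v ⇔ Adj H (Inverse.to bijection u) (Inverse.to bijection v)

infix 10 _[_]

_[_] : ∀ {n} → Graph (Fin n) → (S : Subset n) → Graph (∃ λ v → v ∈ S)
G [ S ] = record
  { Adj         = λ u v → Adj G (proj₁ u) (proj₁ v)
  ; symmetric   = symmetric G
  ; irreflexive = irreflexive G
  }

Colorable : ∀ {V} → ℕ → Graph V → Set
Colorable {V} k G =
  Σ (V → Fin k) λ color → ∀ {u v} → Adj G u v → color u ≢ color v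

MaximalColorable : ∀ {n} → ℕ → Graph (Fin n) → Subset n → Set
MaximalColorable k G S =
  Colorable k (G [ S ]) × (∀ S′ → S ⊂ S′ → ¬ Colorable k (G [ S′ ]))

IsChromaticNumber : ∀ {V} → Graph V → ℕ → Set
IsChromaticNumber G χ = Colorable χ G × (∀ k → Colorable k G → χ ≤ k)

WellHued : ∀ {n} → Graph (Fin n) → Set
WellHued G = ∀ k → 1 ≤ k → ∀ S S′ →
  MaximalColorable k G S → MaximalColorable k G S′ → ∣ S ∣ ≡ ∣ S′ ∣

-- The equation aᵢ = (i / χ) n is stated in ℕ, multiplied through by χ.

WellEquiHued : ∀ {n} → Graph (Fin n) → Set
WellEquiHued {n} G = WellHued G × ∃ λ χ → IsChromaticNumber G χ ×
  (∀ i → 1 ≤ i → i ≤ χ → ∀ S → MaximalColorable i G S → ∣ S ∣ * χ ≡ i * n)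

module _ {k} {V : Fin k → Set} (G : ∀ i → Graph (V i)) where

  data UnionAdj : Σ (Fin k) V → Σ (Fin k) V → Set where
    within : ∀ {i u v} → Adj (G i) u v → UnionAdj (i , u) (i , v)

  data JoinAdj : Σ (Fin k) V → Σ (Fin k) V → Set where
    within  : ∀ {i u v} → Adj (G i) u v → JoinAdj (i , u) (i , v)
    between : ∀ {i j u v} → i ≢ j → JoinAdj (i , u) (j , v)

  disjointUnion : Graph (Σ (Fin k) V)
  disjointUnion = record
    { Adj         = UnionAdj
    ; symmetric   = λ { (within a) → within (symmetric (G _) a) }
    ; irreflexive = λ { (within a) → irreflexive (G _) a }
    }

  join : Graph (Σ (Fin k) V)
  join = record
    { Adj         = JoinAdj
    ; symmetric   = λ { (within a)    → within (symmetric (G _) a)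
                      ; (between i≢j) → between λ j≡i → i≢j (sym j≡i) }
    ; irreflexive = λ { (within a)    → irreflexive (G _) a
                      ; (between i≢i) → i≢i refl }
    }

K₁ : Graph ⊤
K₁ = record
  { Adj         = λ _ _ → ⊥
  ; symmetric   = λ ()
  ; irreflexive = λ ()
  }

-- Families are nonempty, so the graph without vertices is not a cograph.

data Cograph : {V : Set} → Graph V → Set₁ where
  single     : Cograph K₁
  unions     : ∀ {k} {V : Fin (suc k) → Set} {G : ∀ i → Graph (V i)} →
               (∀ i → Cograph (G i)) → Cograph (disjointUnion G)
  joins      : ∀ {k} {V : Fin (suc k) → Set} {G : ∀ i → Graph (V i)} →
               (∀ i → Cograph (G i)) → Cograph (join G)
  isomorphic : ∀ {V W} {G : Graph V} {H : Graph W} →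
               G ≅ H → Cograph G → Cograph H

-- Rooted trees whose internal nodes carry a label 0 or 1.  The labelling of
-- the leaves by vertices is kept apart, in IsCotree below.

data Label : Set where
  𝟘 𝟙 : Label

data Tree : Set where
  leaf : Tree
  node : ∀ {k} → Label → Vector Tree (suc k) → Tree

Leaf : Tree → Set
Leaf leaf = ⊤
Leaf (node _ children) = Σ (Fin _) λ i → Leaf (children i)

⟦_⟧ : (T : Tree) → Graph (Leaf T)
⟦ leaf ⟧             = K₁
⟦ node 𝟘 children ⟧ = disjointUnion λ i → ⟦ children i ⟧
⟦ node 𝟙 children ⟧ = join λ i → ⟦ children i ⟧

-- EveryNode P p T says that P holds at every node of T, where P is told the
-- subtree at the node and the parity of the node's depth, the root of T itself
-- being at depth of parity p.

EveryNode : (Parity → Tree → Set) → Parity → Tree → Set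
EveryNode P p leaf = P p leaf
EveryNode P p (node l children) =
  P p (node l children) × (∀ i → EveryNode P (p ⁻¹) (children i))

AtLeastTwoChildren : Tree → Set
AtLeastTwoChildren leaf = ⊤
AtLeastTwoChildren (node {k} _ _) = 2 ≤ suc k

RootLabelNot : Label → Tree → Set
RootLabelNot l leaf = ⊤
RootLabelNot l (node l′ _) = l ≢ l′

ChildLabelsDiffer : Tree → Set
ChildLabelsDiffer leaf = ⊤
ChildLabelsDiffer (node l children) = ∀ i → RootLabelNot l (children i)

record IsCotree {n} (G : Graph (Fin n)) (T : Tree) : Set where
  field
    labelling   : ⟦ T ⟧ ≅ G
    alternating : EveryNode (λ _ → ChildLabelsDiffer) 0ℙ T
    branching   : n ≢ 1 → EveryNode (λ _ → AtLeastTwoChildren) 0ℙ T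

-- The value assigned to the root of a subtree, given the parity of the
-- distance from that root to the root of the whole cotree.

sum maximum : ∀ {k} → Vector ℕ k → ℕ
sum     = foldr _+_ 0
maximum = foldr _⊔_ 0

procedure₁ : Parity → Tree → ℕ
procedure₁ _  leaf = 1
procedure₁ 0ℙ (node _ children) = sum     λ i → procedure₁ 1ℙ (children i)
procedure₁ 1ℙ (node _ children) = maximum λ i → procedure₁ 0ℙ (children i)

procedure₂ : Parity → Tree → ℕ
procedure₂ _  leaf = 1
procedure₂ 1ℙ (node _ children) = sum     λ i → procedure₂ 0ℙ (children i)
procedure₂ 0ℙ (node _ children) = maximum λ i → procedure₂ 1ℙ (children i)

ChildrenAgree : (Tree → ℕ) → Tree → Set
ChildrenAgree value leaf = ⊤
ChildrenAgree value (node _ children) =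
  ∀ i j → value (children i) ≡ value (children j)

UniformAssignment : Tree → Set
UniformAssignment T =
  EveryNode (λ p t → p ≡ 1ℙ → ChildrenAgree (procedure₁ (p ⁻¹)) t) 0ℙ T ×
  EveryNode (λ p t → p ≡ 0ℙ → ChildrenAgree (procedure₂ (p ⁻¹)) t) 0ℙ T

{-# OPTIONS --safe #-}

-- Let α and ω be the independence and clique numbers.  A set of leaves of a
-- cotree induces a k-colorable subgraph iff its clique number is at most k.
-- Every set S satisfies |S| ≤ α(G) ω(S), by induction over the cotree: the
-- inequality Σ aᵢ bᵢ ≤ (Σ aᵢ) (max bᵢ) serves for both kinds of nodes.
-- A well-equi-hued graph has n = α(G) ω(G), and tightness of this bound forces,
-- at every node, the children to agree on whichever of α and ω is a maximum
-- there, which is uniformity.  Conversely, under uniformity every S of clique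
-- number at most m ≤ ω(G) extends to a set of clique number at most m and order
-- m α(G), so all maximal k-colorable sets have order min(k, ω(G)) α(G).

module Submission where

open import Data.Bool.Base using (Bool; true; false; if_then_else_)
open import Data.Fin.Base using (Fin; zero; suc; splitAt; _↑ˡ_; _↑ʳ_; inject≤)
open import Data.Fin.Properties using (_≟_; injective⇒≤; inject≤-injective;
  splitAt-↑ˡ; splitAt-↑ʳ; join-splitAt)
open import Data.Fin.Subset using (Subset; _∈_; _⊂_; ∣_∣; inside; outside) renaming (⊤ to ⊤ˢ)
open import Data.Fin.Subset.Properties using (∈⊤; ∣⊤∣≡n; p⊂q⇒∣p∣<∣q∣)
open import Data.Nat.Base using (ℕ; zero; suc; _+_; _*_; _∸_; _⊔_; _⊓_; _≤_; z≤n; s≤s; >-nonZero)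
open import Data.Nat.Properties hiding (_≟_)
open import Data.Parity.Base using (Parity; 0ℙ; 1ℙ; _⁻¹)
open import Data.Product.Base using (Σ; ∃; _×_; _,_; proj₁; proj₂)
open import Data.Sum.Base using (inj₁; inj₂)
open import Data.Unit.Base using (⊤; tt)
open import Data.Vec.Base using ([]; _∷_; lookup; tabulate)
open import Data.Vec.Functional using (Vector)
open import Data.Vec.Properties using (lookup⇒[]=; []=⇒lookup; lookup∘tabulate; lookup-replicate)
open import Function.Base using (_∘_; case_of_)
open import Function.Bundles using (_⇔_; mk⇔; Equivalence; Inverse)
open import Relation.Binary.PropositionalEquality hiding ([_])
open import Relation.Nullary.Decidable.Core using (Dec; yes; no)
open import Relation.Nullary.Negation using (contradiction)
open import Algebra.Properties.Semiring.Sum +-*-semiring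
  using (sum-cong-≗; ∑-comm; *-distribˡ-sum; *-distribʳ-sum)
open import Defs

private variable
  k n : ℕ
  f g : Vector ℕ k

-- Sums and maxima of vectors

sum-mono : (∀ i → f i ≤ g i) → sum f ≤ sum g
sum-mono {zero}  f≤g = z≤n
sum-mono {suc k} f≤g = +-mono-≤ (f≤g zero) (sum-mono (f≤g ∘ suc))

maximum-mono : (∀ i → f i ≤ g i) → maximum f ≤ maximum g
maximum-mono {zero}  f≤g = z≤n
maximum-mono {suc k} f≤g = ⊔-mono-≤ (f≤g zero) (maximum-mono (f≤g ∘ suc))

≤sum : (f : Vector ℕ k) → ∀ i → f i ≤ sum f
≤sum f zero    = m≤m+n _ _
≤sum f (suc i) = ≤-trans (≤sum (f ∘ suc) i) (m≤n+m _ _)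

≤maximum : (f : Vector ℕ k) → ∀ i → f i ≤ maximum f
≤maximum f zero    = m≤m⊔n _ _
≤maximum f (suc i) = ≤-trans (≤maximum (f ∘ suc) i) (m≤n⊔m (f zero) _)

maximum-lub : ∀ {m} (f : Vector ℕ k) → (∀ i → f i ≤ m) → maximum f ≤ m
maximum-lub {zero}  f f≤m = z≤n
maximum-lub {suc k} f f≤m = ⊔-lub (f≤m zero) (maximum-lub (f ∘ suc) (f≤m ∘ suc))

maximum-attained : (f : Vector ℕ (suc k)) → ∃ λ i → f i ≡ maximum f
maximum-attained {zero} f = zero , sym (⊔-identityʳ _)
maximum-attained {suc k} f with maximum-attained (f ∘ suc)
                              | ⊔-sel (f zero) (maximum (f ∘ suc))
... | _     | inj₁ eq = zero , sym eq
... | i , e | inj₂ eq = suc i , trans e (sym eq)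

maximum-constant : (f : Vector ℕ k) → (∀ i j → f i ≡ f j) → ∀ i → f i ≡ maximum f
maximum-constant f const i =
  ≤-antisym (≤maximum f i) (maximum-lub f λ j → ≤-reflexive (const j i))

sum-zero : (f : Vector ℕ k) → (∀ i → f i ≡ 0) → sum f ≡ 0
sum-zero {zero}  f f≡0 = refl
sum-zero {suc k} f f≡0 = cong₂ _+_ (f≡0 zero) (sum-zero (f ∘ suc) (f≡0 ∘ suc))

sum-single : ∀ (f : Vector ℕ k) i → (∀ j → j ≢ i → f j ≡ 0) → sum f ≡ f i
sum-single f zero    off =
  trans (cong (f zero +_) (sum-zero (f ∘ suc) λ j → off (suc j) λ ())) (+-identityʳ _)
sum-single f (suc i) off =
  cong₂ _+_ (off zero λ ())
    (sum-single (f ∘ suc) i λ j j≢i → off (suc j) λ { refl → j≢i refl })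

sum-tight : (∀ i → f i ≤ g i) → sum g ≤ sum f → ∀ i → g i ≤ f i
sum-tight {suc k} {f} {g} f≤g Σg≤Σf zero =
  +-cancelʳ-≤ (sum (f ∘ suc)) _ _
    (≤-trans (+-monoʳ-≤ (g zero) (sum-mono (f≤g ∘ suc))) Σg≤Σf)
sum-tight {suc k} {f} {g} f≤g Σg≤Σf (suc i) =
  sum-tight (f≤g ∘ suc)
    (+-cancelˡ-≤ (f zero) _ _ (≤-trans (+-monoˡ-≤ _ (f≤g zero)) Σg≤Σf)) i

-- A discrete intermediate value argument for vectors. It serves to divide the clique budget `m` of
-- a join among its children.
sum-interpolate : (f g : Vector ℕ k) → (∀ i → f i ≤ g i) →
  ∀ m → sum f ≤ m → m ≤ sum g →
  Σ (Vector ℕ k) λ h → (∀ i → f i ≤ h i) × (∀ i → h i ≤ g i) × sum h ≡ m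
sum-interpolate {zero} f g f≤g m _ m≤0 = (λ ()) , (λ ()) , (λ ()) , sym (n≤0⇒n≡0 m≤0)
sum-interpolate {suc k} f g f≤g m Σf≤m m≤Σg =
  let h , f≤h , h≤g , Σh≡ = sum-interpolate (f ∘ suc) (g ∘ suc) (f≤g ∘ suc) (m ∸ h₀) lower upper
  in (λ { zero → h₀ ; (suc i) → h i })
   , (λ { zero → m≤m⊔n _ _ ; (suc i) → f≤h i })
   , (λ { zero → ⊔-lub (f≤g zero) m∸G≤g₀ ; (suc i) → h≤g i })
   , trans (cong (h₀ +_) Σh≡) (m+[n∸m]≡n h₀≤m)
  where
  F = sum (f ∘ suc)
  G = sum (g ∘ suc)
  -- The least first entry above `f zero` whose remainder `m ∸ h₀` the upper bounds of the tail can
  -- still absorb.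
  h₀ = f zero ⊔ (m ∸ G)

  m∸G≤g₀ : m ∸ G ≤ g zero
  m∸G≤g₀ = m≤n+o⇒m∸n≤o m G (≤-trans m≤Σg (≤-reflexive (+-comm (g zero) G)))

  h₀≤m : h₀ ≤ m
  h₀≤m = ⊔-lub (m+n≤o⇒m≤o (f zero) Σf≤m) (m∸n≤m m G)

  lower : F ≤ m ∸ h₀
  lower with ⊔-sel (f zero) (m ∸ G)
  ... | inj₁ eq rewrite eq =
    m+n≤o⇒m≤o∸n F (subst (_≤ m) (+-comm (f zero) F) Σf≤m)
  ... | inj₂ eq rewrite eq with ≤-total G m
  ...   | inj₁ G≤m = ≤-trans (sum-mono (f≤g ∘ suc)) (≤-reflexive (sym (m∸[m∸n]≡n G≤m)))
  -- Subtraction is truncated: here `m ∸ G` is 0, so all of `m` is left for the tail.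
  ...   | inj₂ m≤G rewrite m≤n⇒m∸n≡0 m≤G = m+n≤o⇒n≤o (f zero) Σf≤m

  upper : m ∸ h₀ ≤ G
  upper = m≤n+o⇒m∸n≤o m h₀ (≤-trans (m≤n+m∸n m G)
    (≤-trans (≤-reflexive (+-comm G _)) (+-monoˡ-≤ G (m≤n⊔m (f zero) (m ∸ G)))))

sum-*-≤ : (f g : Vector ℕ k) → sum (λ i → f i * g i) ≤ sum f * maximum g
sum-*-≤ f g = ≤-trans (sum-mono λ i → *-monoʳ-≤ (f i) (≤maximum g i))
  (≤-reflexive (sym (*-distribʳ-sum (maximum g) f)))

-- Termwise `s i ≤ f i * g i ≤ f i * maximum g`. Equal sums force equality in every term, and the
-- positive factor `f i` cancels.
sum-*-tight : (s f g : Vector ℕ k) → (∀ i → s i ≤ f i * g i) → (∀ i → 1 ≤ f i) →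
  sum f * maximum g ≤ sum s → ∀ i → f i * g i ≤ s i × g i ≡ maximum g
sum-*-tight s f g s≤fg f>0 fM≤s i = ≤-trans fg≤fM fM≤sᵢ , ≤-antisym (≤maximum g i)
  (*-cancelˡ-≤ (f i) ⦃ >-nonZero (f>0 i) ⦄ (≤-trans fM≤sᵢ (s≤fg i)))
  where
  fg≤fM : ∀ {i} → f i * g i ≤ f i * maximum g
  fg≤fM {i} = *-monoʳ-≤ (f i) (≤maximum g i)

  fM≤sᵢ : f i * maximum g ≤ s i
  fM≤sᵢ = sum-tight (λ j → ≤-trans (s≤fg j) fg≤fM)
    (≤-trans (≤-reflexive (sym (*-distribʳ-sum (maximum g) f))) fM≤s) i

-- Indexing a disjoint union of finite sets by `Fin (sum f)`

inject-sum : (f : Vector ℕ k) → ∀ i → Fin (f i) → Fin (sum f)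
inject-sum f zero    x = x ↑ˡ _
inject-sum f (suc i) x = f zero ↑ʳ inject-sum (f ∘ suc) i x

split-sum : (f : Vector ℕ k) → Fin (sum f) → Σ (Fin k) (Fin ∘ f)
split-sum {suc k} f x with splitAt (f zero) x
... | inj₁ y = zero , y
... | inj₂ y = let i , z = split-sum (f ∘ suc) y in suc i , z

-- Keeps the palettes of different children of a join apart in `coloring`; the converse
-- `inject-split` keeps the indices of a clique apart in `clique`.
split-inject : ∀ (f : Vector ℕ k) i x → split-sum f (inject-sum f i x) ≡ (i , x)
split-inject f zero    x rewrite splitAt-↑ˡ (f zero) x (sum (f ∘ suc)) = refl
split-inject f (suc i) x
  rewrite splitAt-↑ʳ (f zero) _ (inject-sum (f ∘ suc) i x)
        | split-inject (f ∘ suc) i x = refl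

inject-split : ∀ (f : Vector ℕ k) x → let i , y = split-sum f x in inject-sum f i y ≡ x
inject-split {suc k} f x with splitAt (f zero) x | join-splitAt (f zero) _ x
... | inj₁ y | eq = eq
... | inj₂ y | eq = trans (cong (f zero ↑ʳ_) (inject-split (f ∘ suc) y)) eq

-- Sums over the leaves of a tree

leafSum : ∀ T → (Leaf T → ℕ) → ℕ
leafSum leaf        h = h tt
leafSum (node _ ts) h = sum λ i → leafSum (ts i) λ x → h (i , x)

leafSum-cong : ∀ T {h h′ : Leaf T → ℕ} → (∀ x → h x ≡ h′ x) → leafSum T h ≡ leafSum T h′
leafSum-cong leaf        eq = eq tt
leafSum-cong (node _ ts) eq = sum-cong-≗ λ i → leafSum-cong (ts i) λ x → eq (i , x)

leafSum-zero : ∀ T (h : Leaf T → ℕ) → (∀ x → h x ≡ 0) → leafSum T h ≡ 0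
leafSum-zero leaf        h h≡0 = h≡0 tt
leafSum-zero (node _ ts) h h≡0 = sum-zero _ λ i → leafSum-zero (ts i) _ λ x → h≡0 (i , x)

leafSum-single : ∀ T (h : Leaf T → ℕ) x → (∀ y → y ≢ x → h y ≡ 0) → leafSum T h ≡ h x
leafSum-single leaf        h x       off = refl
leafSum-single (node _ ts) h (i , x) off = trans
  (sum-single _ i λ j j≢i → leafSum-zero (ts j) _ λ y → off (j , y) λ { refl → j≢i refl })
  (leafSum-single (ts i) _ x λ y y≢x → off (i , y) λ { refl → y≢x refl })

leafSum-comm : ∀ T (h : Leaf T → Fin n → ℕ) →
  leafSum T (λ x → sum (h x)) ≡ sum λ v → leafSum T λ x → h x v
leafSum-comm leaf        h = refl
leafSum-comm (node _ ts) h = trans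
  (sum-cong-≗ λ i → leafSum-comm (ts i) λ x → h (i , x))
  (∑-comm λ i v → leafSum (ts i) λ x → h (i , x) v)

-- Double counting: the matrix `δ` vanishes outside the graph of the bijection, so each row and each
-- column contributes a single value of `h`.
leafSum-bijection : ∀ T (to : Leaf T → Fin n) (from : Fin n → Leaf T) →
  (∀ x → from (to x) ≡ x) → (∀ v → to (from v) ≡ v) →
  ∀ (h : Fin n → ℕ) → leafSum T (h ∘ to) ≡ sum h
leafSum-bijection {n} T to from from∘to to∘from h = begin
  leafSum T (h ∘ to)                    ≡⟨ leafSum-cong T row ⟨
  leafSum T (λ x → sum (δ x))           ≡⟨ leafSum-comm T δ ⟩
  sum (λ v → leafSum T λ x → δ x v)     ≡⟨ sum-cong-≗ column ⟩
  sum h                                 ∎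
  where
  open ≡-Reasoning

  at : ∀ {u v : Fin n} → Dec (u ≡ v) → ℕ
  at {v = v} (yes _) = h v
  at         (no _)  = 0

  δ : Leaf T → Fin n → ℕ
  δ x v = at (to x ≟ v)

  at-≡ : ∀ {u v} (d : Dec (u ≡ v)) → u ≡ v → at d ≡ h v
  at-≡ (yes _) _ = refl
  at-≡ (no ¬p) p = contradiction p ¬p

  at-≢ : ∀ {u v} (d : Dec (u ≡ v)) → u ≢ v → at d ≡ 0
  at-≢ (yes p) ¬p = contradiction p ¬p
  at-≢ (no _)  _  = refl

  row : ∀ x → sum (δ x) ≡ h (to x)
  row x = trans (sum-single (δ x) (to x) λ v v≢ → at-≢ (to x ≟ v) (v≢ ∘ sym))
                (at-≡ (to x ≟ to x) refl)

  column : ∀ v → leafSum T (λ x → δ x v) ≡ h v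
  column v = trans
    (leafSum-single T (λ x → δ x v) (from v) λ x x≢ → at-≢ (to x ≟ v)
      λ { refl → x≢ (sym (from∘to x)) })
    (at-≡ (to (from v) ≟ v) (to∘from v))

indicator : Bool → ℕ
indicator b = if b then 1 else 0

size : ∀ T → (Leaf T → Bool) → ℕ
size T S = leafSum T (indicator ∘ S)

-- Clique and independence numbers of cotrees

opposite : Label → Label
opposite 𝟘 = 𝟙
opposite 𝟙 = 𝟘

-- Cliques collect vertices from all children of a join but from one child of a union; independent
-- sets do the opposite. So the parameter named by a label adds up at nodes with that label and is a
-- maximum at the others.
combine : Label → Label → Vector ℕ k → ℕ
combine 𝟘 𝟘 = sum
combine 𝟘 𝟙 = maximum
combine 𝟙 𝟘 = maximum
combine 𝟙 𝟙 = sum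

combine-mono : ∀ l l′ → (∀ i → f i ≤ g i) → combine l l′ f ≤ combine l l′ g
combine-mono 𝟘 𝟘 = sum-mono
combine-mono 𝟘 𝟙 = maximum-mono
combine-mono 𝟙 𝟘 = maximum-mono
combine-mono 𝟙 𝟙 = sum-mono

≤combine : ∀ l l′ (f : Vector ℕ k) i → f i ≤ combine l l′ f
≤combine 𝟘 𝟘 = ≤sum
≤combine 𝟘 𝟙 = ≤maximum
≤combine 𝟙 𝟘 = ≤maximum
≤combine 𝟙 𝟙 = ≤sum

-- The subgraph of ⟦ T ⟧ induced by S has clique number value 𝟙 T S and
-- independence number value 𝟘 T S.

value : Label → (T : Tree) → (Leaf T → Bool) → ℕ
value l leaf         S = indicator (S tt)
value l (node l′ ts) S = combine l l′ λ i → value l (ts i) λ x → S (i , x)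

total : Label → Tree → ℕ
total l T = value l T λ _ → true

value-mono : ∀ l T {S S′ : Leaf T → Bool} →
  (∀ x → S x ≡ true → S′ x ≡ true) → value l T S ≤ value l T S′
value-mono l leaf {S} {S′} S⊆S′ with S tt in eq
... | false = z≤n
... | true rewrite S⊆S′ tt eq = ≤-refl
value-mono l (node l′ ts) S⊆S′ =
  combine-mono l l′ λ i → value-mono l (ts i) λ x → S⊆S′ (i , x)

value-cong : ∀ l T {S S′ : Leaf T → Bool} → (∀ x → S x ≡ S′ x) → value l T S ≡ value l T S′
value-cong l T eq = ≤-antisym
  (value-mono l T λ x → trans (sym (eq x))) (value-mono l T λ x → trans (eq x))

value-empty : ∀ T → value 𝟙 T (λ _ → false) ≡ 0
value-empty leaf        = refl
value-empty (node 𝟘 ts) = n≤0⇒n≡0 (maximum-lub _ λ i → ≤-reflexive (value-empty (ts i)))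
value-empty (node 𝟙 ts) = sum-zero _ (λ i → value-empty (ts i))

total-positive : ∀ l T → 1 ≤ total l T
total-positive l leaf         = ≤-refl
total-positive l (node l′ ts) = ≤-trans (total-positive l (ts zero)) (≤combine l l′ _ zero)

-- Bounding the order by the two parameters, and tightness of the bound

size≤ : ∀ T (S : Leaf T → Bool) → size T S ≤ total 𝟘 T * value 𝟙 T S
size≤ leaf S = ≤-reflexive (sym (*-identityˡ _))
size≤ (node 𝟘 ts) S =
  ≤-trans (sum-mono λ i → size≤ (ts i) λ x → S (i , x))
    (sum-*-≤ (λ i → total 𝟘 (ts i)) (λ i → value 𝟙 (ts i) λ x → S (i , x)))
size≤ (node 𝟙 ts) S = begin
  sum (λ i → size (ts i) λ x → S (i , x))  ≤⟨ sum-mono (λ i → size≤ (ts i) λ x → S (i , x)) ⟩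
  sum (λ i → α i * w i)                    ≡⟨ sum-cong-≗ (λ i → *-comm (α i) (w i)) ⟩
  -- Compared with a union, the factors exchange roles: at a join clique numbers add and
  -- independence numbers are maximized.
  sum (λ i → w i * α i)                    ≤⟨ sum-*-≤ w α ⟩
  sum w * maximum α                        ≡⟨ *-comm (sum w) (maximum α) ⟩
  maximum α * sum w                        ∎
  where
  open ≤-Reasoning
  α = λ i → total 𝟘 (ts i)
  w = λ i → value 𝟙 (ts i) λ x → S (i , x)

-- The uniform assignment property freed of depths and procedures: siblings must agree on the
-- parameter that is a maximum at their parent.
Uniform : Tree → Set
Uniform leaf        = ⊤
Uniform (node l ts) =
  (∀ i j → total (opposite l) (ts i) ≡ total (opposite l) (ts j)) × (∀ i → Uniform (ts i))

-- Tightness is inherited: `sum-*-tight` yields both the agreement of the children and the tightness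
-- of the bound at each child.
size-tight⇒uniform : ∀ T → total 𝟘 T * total 𝟙 T ≤ size T (λ _ → true) → Uniform T
size-tight⇒uniform leaf        _ = tt
size-tight⇒uniform (node 𝟘 ts) αω≤n =
  (λ i j → trans (proj₂ (tight i)) (sym (proj₂ (tight j)))) ,
  (λ i → size-tight⇒uniform (ts i) (proj₁ (tight i)))
  where
  tight = sum-*-tight (λ i → size (ts i) λ _ → true) (λ i → total 𝟘 (ts i)) (λ i → total 𝟙 (ts i))
    (λ i → size≤ (ts i) λ _ → true)
    (λ i → total-positive 𝟘 (ts i)) αω≤n
size-tight⇒uniform (node 𝟙 ts) αω≤n =
  (λ i j → trans (proj₂ (tight i)) (sym (proj₂ (tight j)))) ,
  (λ i → size-tight⇒uniform (ts i)
    (≤-trans (≤-reflexive (*-comm (α i) (ω i))) (proj₁ (tight i))))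
  where
  α = λ i → total 𝟘 (ts i)
  ω = λ i → total 𝟙 (ts i)
  tight = sum-*-tight (λ i → size (ts i) λ _ → true) ω α
    (λ i → ≤-trans (size≤ (ts i) λ _ → true) (≤-reflexive (*-comm (α i) (ω i))))
    (λ i → total-positive 𝟙 (ts i))
    (≤-trans (≤-reflexive (*-comm (sum ω) (maximum α))) αω≤n)

-- At a union each child uses the whole budget `m`; at a join the budget is divided. The orders add
-- up as required because independence numbers add at a union and are common to all children at a
-- join.
extend : ∀ T → Uniform T → ∀ S m → value 𝟙 T S ≤ m → m ≤ total 𝟙 T →
  Σ (Leaf T → Bool) λ S′ → (∀ x → S x ≡ true → S′ x ≡ true) ×
    value 𝟙 T S′ ≤ m × size T S′ ≡ m * total 𝟘 T
extend leaf _ S zero       w≤m _ = S , (λ _ p → p) , w≤m , n≤0⇒n≡0 w≤m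
extend leaf _ S (suc zero) _   _ = (λ _ → true) , (λ _ _ → refl) , ≤-refl , refl
extend leaf _ S (suc (suc m)) _ (s≤s ())
extend (node 𝟘 ts) (agree , u) S m w≤m m≤ω =
  (λ (i , x) → proj₁ (part i) x) ,
  (λ (i , x) → proj₁ (proj₂ (part i)) x) ,
  maximum-lub _ (λ i → proj₁ (proj₂ (proj₂ (part i)))) ,
  trans (sum-cong-≗ λ i → proj₂ (proj₂ (proj₂ (part i))))
        (sym (*-distribˡ-sum m λ i → total 𝟘 (ts i)))
  where
  part = λ i → extend (ts i) (u i) (λ x → S (i , x)) m
    (≤-trans (≤maximum (λ j → value 𝟙 (ts j) λ x → S (j , x)) i) w≤m)
    -- Agreement gives every child the clique number of the whole union, so `m` is an admissible
    -- budget in each of them.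
    (≤-trans m≤ω (≤-reflexive (sym (maximum-constant _ agree i))))
extend (node 𝟙 ts) (agree , u) S m w≤m m≤ω with
  -- Child `i` may receive anything from the clique number of its part of `S` up to its own clique
  -- number.
  sum-interpolate _ _ (λ i → value-mono 𝟙 (ts i) {λ x → S (i , x)} λ _ _ → refl) m w≤m m≤ω
... | h , w≤h , h≤ω , refl =
  (λ (i , x) → proj₁ (part i) x) ,
  (λ (i , x) → proj₁ (proj₂ (part i)) x) ,
  sum-mono (λ i → proj₁ (proj₂ (proj₂ (part i)))) ,
  trans (sum-cong-≗ λ i → trans (proj₂ (proj₂ (proj₂ (part i))))
                                (cong (h i *_) (maximum-constant _ agree i)))
        (sym (*-distribʳ-sum (total 𝟘 (node 𝟙 ts)) h))
  where
  part = λ i → extend (ts i) (u i) (λ x → S (i , x)) (h i) (w≤h i) (h≤ω i)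

-- A union takes the sets of all children, a join only that of a child with the largest independence
-- number. The result is the test set for the equation on maximal 1-colorable subgraphs.
maximum-independent : ∀ T → Σ (Leaf T → Bool) λ S →
  value 𝟙 T S ≤ 1 × size T S ≡ total 𝟘 T
maximum-independent leaf = (λ _ → true) , ≤-refl , refl
maximum-independent (node 𝟘 ts) =
  (λ (i , x) → proj₁ (part i) x) ,
  maximum-lub _ (λ i → proj₁ (proj₂ (part i))) ,
  sum-cong-≗ (λ i → proj₂ (proj₂ (part i)))
  where part = λ i → maximum-independent (ts i)
maximum-independent (node 𝟙 ts) with maximum-attained (λ i → total 𝟘 (ts i))
... | i , attained with maximum-independent (ts i)
...   | S , w≤1 , size≡α =
  (λ (j , x) → only (i ≟ j) x) ,
  ≤-trans (≤-reflexive (isolated (value 𝟙) value-empty)) w≤1 ,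
  trans (isolated size λ T → leafSum-zero T _ λ _ → refl) (trans size≡α attained)
  where
  only : ∀ {j} → Dec (i ≡ j) → Leaf (ts j) → Bool
  only (yes refl) = S
  only (no _)     = λ _ → false

  -- Generic in `φ` because both the clique number and the order are sums over the children of a
  -- join.
  isolated : (φ : ∀ T → (Leaf T → Bool) → ℕ) → (∀ T → φ T (λ _ → false) ≡ 0) →
    sum (λ j → φ (ts j) (only (i ≟ j))) ≡ φ (ts i) S
  isolated φ φ∅ = trans (sum-single _ i (λ j j≢i → off j j≢i (i ≟ j))) (on (i ≟ i))
    where
    off : ∀ j → j ≢ i → (d : Dec (i ≡ j)) → φ (ts j) (only d) ≡ 0
    off j j≢i (yes refl) = contradiction refl j≢i
    off j j≢i (no _)     = φ∅ (ts j)

    on : (d : Dec (i ≡ i)) → φ (ts i) (only d) ≡ φ (ts i) S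
    on (yes refl) = refl
    on (no i≢i)   = contradiction refl i≢i

-- Cliques and colorings witnessing that cographs are perfect

clique : ∀ T (S : Leaf T → Bool) → Σ (Fin (value 𝟙 T S) → Leaf T) λ q →
  (∀ x → S (q x) ≡ true) × (∀ x y → x ≢ y → Adj ⟦ T ⟧ (q x) (q y))
clique leaf S with S tt in eq
... | true  = (λ _ → tt) , (λ _ → eq) , λ { zero zero 0≢0 → contradiction refl 0≢0 }
... | false = (λ _ → tt) , (λ ()) , λ ()
clique (node 𝟘 ts) S
  with maximum-attained (λ i → value 𝟙 (ts i) λ x → S (i , x))
... | i , attained =
  subst (λ w → Σ (Fin w → Leaf (node 𝟘 ts)) λ q →
      (∀ x → S (q x) ≡ true) × (∀ x y → x ≢ y → UnionAdj (λ i → ⟦ ts i ⟧) (q x) (q y)))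
    attained
    (let q , q∈S , adj = clique (ts i) (λ x → S (i , x))
     in (λ x → i , q x) , q∈S , λ x y x≢y → within (adj x y x≢y))
clique (node 𝟙 ts) S =
  (λ x → let i , y = split-sum w x in i , proj₁ (part i) y) ,
  (λ x → let i , y = split-sum w x in proj₁ (proj₂ (part i)) y) ,
  (λ x y x≢y → adjacent (split-sum w x) (split-sum w y) λ eq →
    x≢y (trans (sym (inject-split w x))
      (trans (cong (λ (i , z) → inject-sum w i z) eq) (inject-split w y))))
  where
  w = λ i → value 𝟙 (ts i) λ x → S (i , x)
  part = λ i → clique (ts i) λ x → S (i , x)

  adjacent : ∀ ((i , x) (j , y) : Σ (Fin _) (Fin ∘ w)) → (i , x) ≢ (j , y) →
    JoinAdj (λ i → ⟦ ts i ⟧) (i , proj₁ (part i) x) (j , proj₁ (part j) y)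
  adjacent (i , x) (j , y) ≢ with i ≟ j
  ... | yes refl = within (proj₂ (proj₂ (part i)) x y λ { refl → ≢ refl })
  ... | no i≢j   = between i≢j

-- The children of a union share one palette, as large as the most demanding child requires; those
-- of a join get disjoint blocks of colors. Only members of `S` are colored, since the palette is
-- empty when `S` is.
coloring : ∀ T (S : Leaf T → Bool) →
  Σ (∀ x → S x ≡ true → Fin (value 𝟙 T S)) λ c →
    ∀ {x y} p q → Adj ⟦ T ⟧ x y → c x p ≢ c y q
coloring leaf S = (λ _ p → subst (Fin ∘ indicator) (sym p) zero) , λ _ _ ()
coloring (node 𝟘 ts) S =
  (λ (i , x) p → inject≤ (proj₁ (part i) x p) (≤maximum w i)) ,
  λ { p q (within {i} adj) eq →
      proj₂ (part i) p q adj (inject≤-injective (≤maximum w i) (≤maximum w i) _ _ eq) }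
  where
  w = λ i → value 𝟙 (ts i) λ x → S (i , x)
  part = λ i → coloring (ts i) λ x → S (i , x)
coloring (node 𝟙 ts) S =
  (λ (i , x) p → inject-sum w i (proj₁ (part i) x p)) ,
  λ { {x} {y} p q adj eq → distinct p q adj
        (trans (sym (split-inject w _ _)) (trans (cong (split-sum w) eq) (split-inject w _ _))) }
  where
  w = λ i → value 𝟙 (ts i) λ x → S (i , x)
  part = λ i → coloring (ts i) λ x → S (i , x)

  Σ-injectiveʳ : ∀ {i} {x y : Fin (w i)} → _≡_ {A = Σ _ (Fin ∘ w)} (i , x) (i , y) → x ≡ y
  Σ-injectiveʳ refl = refl

  distinct : ∀ {(i , x) (j , y) : Leaf (node 𝟙 ts)} p q →
    JoinAdj (λ i → ⟦ ts i ⟧) (i , x) (j , y) →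
    _≢_ {A = Σ _ (Fin ∘ w)} (i , proj₁ (part i) x p) (j , proj₁ (part j) y q)
  distinct p q (within adj)  eq = proj₂ (part _) p q adj (Σ-injectiveʳ eq)
  distinct p q (between i≢j) eq = i≢j (cong proj₁ eq)

-- Labels in a cotree alternate with depth, so the procedures compute totals

Alternating : Label → Tree → Set
Alternating l leaf         = ⊤
Alternating l (node l′ ts) = l ≡ l′ × (∀ i → Alternating (opposite l) (ts i))

alternates : ∀ l p T → EveryNode (λ _ → ChildLabelsDiffer) p T →
  RootLabelNot (opposite l) T → Alternating l T
alternates l p leaf        _ _ = tt
alternates 𝟘 p (node 𝟘 ts) (differ , sub) _ =
  refl , λ i → alternates 𝟙 (p ⁻¹) (ts i) (sub i) (differ i)
alternates 𝟙 p (node 𝟙 ts) (differ , sub) _ =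
  refl , λ i → alternates 𝟘 (p ⁻¹) (ts i) (sub i) (differ i)
alternates 𝟘 p (node 𝟙 ts) _ ≢ = contradiction refl ≢
alternates 𝟙 p (node 𝟘 ts) _ ≢ = contradiction refl ≢

rootLabel : Tree → Label
-- An arbitrary choice: a single leaf alternates for either label.
rootLabel leaf       = 𝟘
rootLabel (node l _) = l

rootLabelNot-opposite : ∀ T → RootLabelNot (opposite (rootLabel T)) T
rootLabelNot-opposite leaf       = tt
rootLabelNot-opposite (node 𝟘 _) ()
rootLabelNot-opposite (node 𝟙 _) ()

labelAt : Parity → Label → Label
labelAt 0ℙ r = r
labelAt 1ℙ r = opposite r

alternating-child : ∀ p r {l} {ts : Vector Tree (suc k)} →
  Alternating (labelAt p r) (node l ts) → ∀ i → Alternating (labelAt (p ⁻¹) r) (ts i)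
alternating-child 0ℙ r (_ , alt) = alt
alternating-child 1ℙ 𝟘 (_ , alt) = alt
alternating-child 1ℙ 𝟙 (_ , alt) = alt

maximum-cong : (∀ i → f i ≡ g i) → maximum f ≡ maximum g
maximum-cong f≡g = ≤-antisym (maximum-mono λ i → ≤-reflexive (f≡g i))
                             (maximum-mono λ i → ≤-reflexive (sym (f≡g i)))

-- Internal nodes at even depth carry the root's label `r` and those at odd depth the other one, so
-- the sums and maxima of procedure 1 are those defining the parameter named by `r`.
procedure₁≡total : ∀ p r T → Alternating (labelAt p r) T → procedure₁ p T ≡ total r T
procedure₁≡total _  r leaf _ = refl
procedure₁≡total 0ℙ 𝟘 (node 𝟘 ts) (_ , alt) = sum-cong-≗ λ i → procedure₁≡total 1ℙ 𝟘 (ts i) (alt i)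
procedure₁≡total 0ℙ 𝟙 (node 𝟙 ts) (_ , alt) = sum-cong-≗ λ i → procedure₁≡total 1ℙ 𝟙 (ts i) (alt i)
procedure₁≡total 1ℙ 𝟘 (node 𝟙 ts) (_ , alt) = maximum-cong λ i → procedure₁≡total 0ℙ 𝟘 (ts i) (alt i)
procedure₁≡total 1ℙ 𝟙 (node 𝟘 ts) (_ , alt) = maximum-cong λ i → procedure₁≡total 0ℙ 𝟙 (ts i) (alt i)

-- The two procedures differ only by a shift of the depth by one.
procedure₂≡procedure₁ : ∀ p T → procedure₂ p T ≡ procedure₁ (p ⁻¹) T
procedure₂≡procedure₁ _  leaf = refl
procedure₂≡procedure₁ 0ℙ (node _ ts) = maximum-cong λ i → procedure₂≡procedure₁ 1ℙ (ts i)
procedure₂≡procedure₁ 1ℙ (node _ ts) = sum-cong-≗ λ i → procedure₂≡procedure₁ 0ℙ (ts i)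

-- The value that the property compares among the children of a node at depth parity `p`; the
-- procedure concerned takes a maximum at that node.
agreement : Parity → Tree → ℕ
agreement 0ℙ = procedure₂ 1ℙ
agreement 1ℙ = procedure₁ 0ℙ

agreement≡total : ∀ p r l (ts : Vector Tree (suc k)) → Alternating (labelAt p r) (node l ts) →
  ∀ i → agreement p (ts i) ≡ total (opposite l) (ts i)
agreement≡total 0ℙ r r ts (refl , alt) i =
  trans (procedure₂≡procedure₁ 1ℙ (ts i)) (procedure₁≡total 0ℙ (opposite r) (ts i) (alt i))
agreement≡total 1ℙ 𝟘 𝟙 ts (refl , alt) i = procedure₁≡total 0ℙ 𝟘 (ts i) (alt i)
agreement≡total 1ℙ 𝟙 𝟘 ts (refl , alt) i = procedure₁≡total 0ℙ 𝟙 (ts i) (alt i)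

Assignment₁ Assignment₂ : Parity → Tree → Set
Assignment₁ = EveryNode λ p t → p ≡ 1ℙ → ChildrenAgree (procedure₁ (p ⁻¹)) t
Assignment₂ = EveryNode λ p t → p ≡ 0ℙ → ChildrenAgree (procedure₂ (p ⁻¹)) t

assignment⇒uniform : ∀ p r T → Alternating (labelAt p r) T →
  Assignment₁ p T → Assignment₂ p T → Uniform T
assignment⇒uniform p r leaf        alt _ _ = tt
assignment⇒uniform p r (node l ts) alt (a₁ , sub₁) (a₂ , sub₂) =
  (λ i j → trans (sym (agreement≡total p r l ts alt i))
             (trans (agree p a₁ a₂ i j) (agreement≡total p r l ts alt j))) ,
  (λ i → assignment⇒uniform (p ⁻¹) r (ts i) (alternating-child p r alt i) (sub₁ i) (sub₂ i))
  where
  agree : ∀ p → (p ≡ 1ℙ → ChildrenAgree (procedure₁ (p ⁻¹)) (node l ts)) →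
    (p ≡ 0ℙ → ChildrenAgree (procedure₂ (p ⁻¹)) (node l ts)) →
    ChildrenAgree (agreement p) (node l ts)
  agree 0ℙ _ a₂ = a₂ refl
  agree 1ℙ a₁ _ = a₁ refl

uniform⇒assignment : ∀ p r T → Alternating (labelAt p r) T →
  Uniform T → Assignment₁ p T × Assignment₂ p T
uniform⇒assignment p r leaf        alt _ = (λ _ → tt) , (λ _ → tt)
uniform⇒assignment p r (node l ts) alt (eq , u) =
  ((λ { refl → agree }) , proj₁ ∘ sub) ,
  ((λ { refl → agree }) , proj₂ ∘ sub)
  where
  agree : ChildrenAgree (agreement p) (node l ts)
  agree i j = trans (agreement≡total p r l ts alt i)
                (trans (eq i j) (sym (agreement≡total p r l ts alt j)))

  sub = λ i → uniform⇒assignment (p ⁻¹) r (ts i) (alternating-child p r alt i) (u i)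

uniform⇔uniformAssignment : ∀ T → EveryNode (λ _ → ChildLabelsDiffer) 0ℙ T →
  Uniform T ⇔ UniformAssignment T
uniform⇔uniformAssignment T differ = mk⇔
  (uniform⇒assignment 0ℙ (rootLabel T) T alt)
  (λ (a₁ , a₂) → assignment⇒uniform 0ℙ (rootLabel T) T alt a₁ a₂)
  where alt = alternates (rootLabel T) 0ℙ T differ (rootLabelNot-opposite T)

-- Transfer from leaf sets to vertex sets of the labelled graph

∣S∣≡sum : (S : Subset n) → ∣ S ∣ ≡ sum (indicator ∘ lookup S)
∣S∣≡sum []            = refl
∣S∣≡sum (inside  ∷ S) = cong suc (∣S∣≡sum S)
∣S∣≡sum (outside ∷ S) = ∣S∣≡sum S

module _ (G : Graph (Fin n)) (T : Tree) (labelling : ⟦ T ⟧ ≅ G) where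

  open _≅_ labelling
  open Inverse bijection using (to; from; strictlyInverseˡ; strictlyInverseʳ)

  pullback : Subset n → Leaf T → Bool
  pullback S x = lookup S (to x)

  pushforward : (Leaf T → Bool) → Subset n
  pushforward S = tabulate (S ∘ from)

  pullback-pushforward : ∀ S x → pullback (pushforward S) x ≡ S x
  pullback-pushforward S x =
    trans (lookup∘tabulate _ (to x)) (cong S (strictlyInverseʳ x))

  ∣S∣≡size : ∀ S → ∣ S ∣ ≡ size T (pullback S)
  ∣S∣≡size S = trans (∣S∣≡sum S)
    (sym (leafSum-bijection T to from strictlyInverseʳ strictlyInverseˡ (indicator ∘ lookup S)))

  ∣pushforward∣ : ∀ S → ∣ pushforward S ∣ ≡ size T S
  ∣pushforward∣ S = trans (∣S∣≡size (pushforward S))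
    (leafSum-cong T λ x → cong indicator (pullback-pushforward S x))

  ω : Subset n → ℕ
  ω S = value 𝟙 T (pullback S)

  ω-pushforward : ∀ S → ω (pushforward S) ≡ value 𝟙 T S
  ω-pushforward S = value-cong 𝟙 T (pullback-pushforward S)

  ω-⊤ : ω ⊤ˢ ≡ total 𝟙 T
  ω-⊤ = value-cong 𝟙 T λ x → lookup-replicate (to x) true

  -- A proper coloring is injective on a clique, and `clique` provides one of order `ω S` inside
  -- `S`.
  colorable⇒ω≤ : ∀ S → Colorable k (G [ S ]) → ω S ≤ k
  colorable⇒ω≤ S (c , proper) = injective⇒≤ {f = λ x → c (vertex x)} injective
    where
    q      = proj₁ (clique T (pullback S))
    q∈S    = proj₁ (proj₂ (clique T (pullback S)))
    q-adj  = proj₂ (proj₂ (clique T (pullback S)))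
    vertex = λ x → to (q x) , lookup⇒[]= (to (q x)) S (q∈S x)

    injective : ∀ {x y} → c (vertex x) ≡ c (vertex y) → x ≡ y
    injective {x} {y} eq with x ≟ y
    ... | yes x≡y = x≡y
    ... | no x≢y  = contradiction eq
      (proper {vertex x} {vertex y} (Equivalence.to (adjacency _ _) (q-adj x y x≢y)))

  ω≤⇒colorable : ∀ S → ω S ≤ k → Colorable k (G [ S ])
  ω≤⇒colorable S ω≤k =
    (λ (v , v∈S) → inject≤ (c (from v) (∈⇒true v∈S)) ω≤k) ,
    λ {(u , u∈S)} {(v , v∈S)} adj eq →
      proj₂ (coloring T (pullback S)) (∈⇒true u∈S) (∈⇒true v∈S)
        (Equivalence.from (adjacency (from u) (from v))
          (subst₂ (Adj G) (sym (strictlyInverseˡ u)) (sym (strictlyInverseˡ v)) adj))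
        (inject≤-injective ω≤k ω≤k _ _ eq)
    where
    c = proj₁ (coloring T (pullback S))

    ∈⇒true : ∀ {v} → v ∈ S → pullback S (from v) ≡ true
    ∈⇒true {v} v∈S = trans (cong (lookup S) (strictlyInverseˡ v)) ([]=⇒lookup v∈S)

  colorable⇒total≤ : Colorable k G → total 𝟙 T ≤ k
  colorable⇒total≤ (c , proper) =
    subst (_≤ _) ω-⊤ (colorable⇒ω≤ ⊤ˢ ((λ (v , _) → c v) , proper))

  colorable-total : Colorable (total 𝟙 T) G
  colorable-total =
    let c , proper = ω≤⇒colorable ⊤ˢ (≤-reflexive ω-⊤)
    in (λ v → c (v , ∈⊤)) , λ {u} {v} → proper {u , ∈⊤} {v , ∈⊤}

  -- The equation for `i = 1` on a maximum independent set reads α χ = n. Since χ is the clique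
  -- number, the bound `size≤` is tight for the whole tree.
  wellEquiHued⇒uniform : WellEquiHued G → Uniform T
  wellEquiHued⇒uniform (_ , χ , (χ-colorable , χ-minimal) , equi)
    with maximum-independent T
  ... | S , w≤1 , size≡α = size-tight⇒uniform T (begin
    total 𝟘 T * total 𝟙 T     ≡⟨ cong₂ _*_ (trans (sym size≡α) (sym (∣pushforward∣ S))) ω≡χ ⟩
    ∣ pushforward S ∣ * χ     ≡⟨ equi 1 ≤-refl (subst (1 ≤_) ω≡χ (total-positive 𝟙 T)) _ maximal ⟩
    1 * n                     ≡⟨ *-identityˡ n ⟩
    n                         ≡⟨ ∣⊤∣≡n n ⟨
    ∣ ⊤ˢ {n} ∣                ≡⟨ ∣S∣≡size ⊤ˢ ⟩
    size T (pullback ⊤ˢ)      ≡⟨ leafSum-cong T (λ x → cong indicator (lookup-replicate (to x) true)) ⟩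
    size T (λ _ → true)       ∎)
    where
    open ≤-Reasoning
    ω≡χ : total 𝟙 T ≡ χ
    ω≡χ = ≤-antisym (colorable⇒total≤ χ-colorable) (χ-minimal _ colorable-total)

    maximal : MaximalColorable 1 G (pushforward S)
    maximal = ω≤⇒colorable _ (≤-trans (≤-reflexive (ω-pushforward S)) w≤1) ,
      -- A proper superset of clique number at most 1 would exceed the independence number, contrary
      -- to `size≤`.
      λ S′ S⊂S′ colorable → <-irrefl refl (<-≤-trans (p⊂q⇒∣p∣<∣q∣ S⊂S′)
        (bound S′ (colorable⇒ω≤ S′ colorable)))
      where
      bound : ∀ S′ → ω S′ ≤ 1 → ∣ S′ ∣ ≤ ∣ pushforward S ∣
      bound S′ ω≤1 = begin
        ∣ S′ ∣                ≡⟨ ∣S∣≡size S′ ⟩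
        size T (pullback S′)  ≤⟨ size≤ T (pullback S′) ⟩
        total 𝟘 T * ω S′      ≤⟨ *-monoʳ-≤ (total 𝟘 T) ω≤1 ⟩
        total 𝟘 T * 1         ≡⟨ *-identityʳ _ ⟩
        total 𝟘 T             ≡⟨ size≡α ⟨
        size T S              ≡⟨ ∣pushforward∣ S ⟨
        ∣ pushforward S ∣     ∎

  -- The set given by `extend` contains `S` and is `k`-colorable, so by maximality it is `S`. The
  -- minimum is there because `extend` accepts no budget above the clique number.
  uniform⇒maximal-size : Uniform T → ∀ S → MaximalColorable k G S →
    ∣ S ∣ ≡ (k ⊓ total 𝟙 T) * total 𝟘 T
  uniform⇒maximal-size {k} u S (colorable , maximal)
    with extend T u (pullback S) (k ⊓ total 𝟙 T)
           (⊓-glb (colorable⇒ω≤ S colorable) (value-mono 𝟙 T λ _ _ → refl)) (m⊓n≤n k _)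
  ... | S′ , S⊆S′ , w≤ , size≡ = trans (∣S∣≡size S)
    (trans (leafSum-cong T λ x → cong indicator (S≗S′ x)) size≡)
    where
    larger : ∀ x → S′ x ≡ true → pullback S x ≢ true → S ⊂ pushforward S′
    larger x x∈S′ x∉S =
      (λ {v} v∈S → lookup⇒[]= v _ (trans (lookup∘tabulate _ v)
        (S⊆S′ (from v) (trans (cong (lookup S) (strictlyInverseˡ v)) ([]=⇒lookup v∈S))))) ,
      to x , lookup⇒[]= _ _ (trans (pullback-pushforward S′ x) x∈S′) ,
      λ x∈S → x∉S ([]=⇒lookup x∈S)

    S≗S′ : ∀ x → pullback S x ≡ S′ x
    S≗S′ x with pullback S x in p | S′ x in q
    ... | true  | true  = refl
    ... | false | false = refl
    ... | true  | false = trans (sym (S⊆S′ x p)) q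
    -- A leaf added by `extend` would make `pushforward S′` a strictly larger `k`-colorable set.
    ... | false | true  = contradiction
      (ω≤⇒colorable _ (≤-trans (≤-reflexive (ω-pushforward S′)) (≤-trans w≤ (m⊓n≤m k _))))
      (maximal _ (larger x q λ p′ → case trans (sym p) p′ of λ ()))

  uniform⇒wellEquiHued : Uniform T → WellEquiHued G
  uniform⇒wellEquiHued u =
    (λ k _ S S′ max max′ → trans (uniform⇒maximal-size u S max) (sym (uniform⇒maximal-size u S′ max′))) ,
    total 𝟙 T , (colorable-total , λ _ → colorable⇒total≤) ,
    λ i _ i≤ω S max → begin
      ∣ S ∣ * total 𝟙 T                          ≡⟨ cong (_* total 𝟙 T) (uniform⇒maximal-size u S max) ⟩
      (i ⊓ total 𝟙 T) * total 𝟘 T * total 𝟙 T   ≡⟨ cong (λ m → m * total 𝟘 T * total 𝟙 T) (m≤n⇒m⊓n≡m i≤ω) ⟩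
      i * total 𝟘 T * total 𝟙 T                 ≡⟨ *-assoc i _ _ ⟩
      i * (total 𝟘 T * total 𝟙 T)               ≡⟨ cong (i *_) (*-comm (total 𝟘 T) _) ⟩
      -- The order `n` comes from the size formula itself, applied to the whole vertex set; `⊓-idem`
      -- brings the budget into the form required there.
      i * (total 𝟙 T * total 𝟘 T)               ≡⟨ cong (λ m → i * (m * total 𝟘 T)) (⊓-idem (total 𝟙 T)) ⟨
      i * ((total 𝟙 T ⊓ total 𝟙 T) * total 𝟘 T) ≡⟨ cong (i *_) (uniform⇒maximal-size u ⊤ˢ ⊤-maximal) ⟨
      i * ∣ ⊤ˢ {n} ∣                            ≡⟨ cong (i *_) (∣⊤∣≡n n) ⟩
      i * n                                     ∎
    where
    open ≡-Reasoning
    ⊤-maximal : MaximalColorable (total 𝟙 T) G ⊤ˢ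
    ⊤-maximal = ω≤⇒colorable ⊤ˢ (≤-reflexive ω-⊤) , λ _ (_ , _ , _ , x∉⊤) _ → x∉⊤ ∈⊤

theorem11 : ∀ {n : ℕ} (G : Graph (Fin n)) → Cograph G →
    ∀ (T : Tree) → IsCotree G T → WellEquiHued G ⇔ UniformAssignment T
theorem11 G _ T cotree = mk⇔
  (Equivalence.to property ∘ wellEquiHued⇒uniform G T labelling)
  (uniform⇒wellEquiHued G T labelling ∘ Equivalence.from property)
  where
  open IsCotree cotree
  property = uniform⇔uniformAssignment T alternating
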